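{- The class of tolerance graphs contains a graph that is not a pairwise compatibility graph; i.e., tolerance graphs are not contained in PCG.
   Context: All graphs are finite and simple. A graph $G=(V,E)$ is a pairwise compatibility graph (PCG) if there exist a tree $T$ with non-negative real edge weights, whose set of leaves is exactly $V$, and two non-negative real numbers $d_{min}\le d_{max}$ such that for all distinct $u,v\in V$, $(u,v)\in E$ if and only if $d_{min}\le d_T(u,v)\le d_{max}$, where $d_T(u,v)$ is the sum of the weights of the edges on the unique path from $u$ to $v$ in $T$. A graph $G=(V,E)$ is a tolerance graph if to every node $v$ one can assign a closed interval $I_v$ of the real line and a tolerance $t_v\ge 0$ such that distinct $x,y$ are adjacent if and only if $|I_x\cap I_y|\ge \min\{t_x,t_y\}$, where $|I|$ denotes the length of the interval $I$. -}

module Defs where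

open import Level using (0ℓ)
open import Data.Nat.Base as ℕ using (ℕ)
import Data.Nat.Properties as ℕₚ
open import Data.Fin.Base using (Fin)
open import Data.List.Base using (List; []; _∷_)
open import Data.List.Relation.Unary.Unique.Propositional using (Unique)
open import Data.Product using (∃; ∃!; _×_; _,_; proj₁)
open import Data.Rational.Base as ℚ using (ℚ; 0ℚ; ½)
import Data.Rational.Properties as ℚₚ
open import Data.Rational.Solver using (module +-*-Solver)
open import Data.Sum.Base using (inj₁; inj₂)
open import Function.Base using (_on_)
open import Function.Bundles using (_⇔_)
open import Function.Definitions using (Injective)
open import Relation.Binary.Core using (Rel)
open import Relation.Binary.Definitions using (Decidable; Symmetric; Irreflexive)
open import Relation.Binary.Construct.Closure.ReflexiveTransitive using (Star; ε; _◅_)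
open import Relation.Binary.PropositionalEquality
  using (_≡_; _≢_; refl; sym; cong₂; subst)

IsCauchy : (ℕ → ℚ) → Set
IsCauchy x = ∀ e → 0ℚ ℚ.< e → ∃ λ N → ∀ m n → N ℕ.≤ m → N ℕ.≤ n →
             ℚ.∣ x m ℚ.- x n ∣ ℚ.< e

-- Sequences are not quotiented: equality of reals is _≃_ below, not _≡_.
record ℝ : Set where
  constructor mkℝ
  field
    seq    : ℕ → ℚ
    cauchy : IsCauchy seq

open ℝ public

infix  4 _≤_ _≃_
infixl 6 _+_ _-_ _⊔_
infixl 7 _⊓_

_≤_ : Rel ℝ 0ℓ
x ≤ y = ∀ e → 0ℚ ℚ.< e → ∃ λ N → ∀ n → N ℕ.≤ n → seq x n ℚ.≤ seq y n ℚ.+ e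

_≃_ : Rel ℝ 0ℓ
x ≃ y = x ≤ y × y ≤ x

fromℚ : ℚ → ℝ
fromℚ q = mkℝ (λ _ → q) λ e 0<e → 0 , λ _ _ _ _ →
  subst (ℚ._< e) (sym (∣q-q∣≡0 q)) 0<e
  where
  ∣q-q∣≡0 : ∀ q → ℚ.∣ q ℚ.- q ∣ ≡ 0ℚ
  ∣q-q∣≡0 q rewrite ℚₚ.+-inverseʳ q = refl

0ℝ : ℝ
0ℝ = fromℚ 0ℚ

NonExpansive : (ℚ → ℚ → ℚ) → Set
NonExpansive f = ∀ a b c d →
  ℚ.∣ f a b ℚ.- f c d ∣ ℚ.≤ ℚ.∣ a ℚ.- c ∣ ℚ.+ ℚ.∣ b ℚ.- d ∣

lift₂ : (f : ℚ → ℚ → ℚ) → NonExpansive f → ℝ → ℝ → ℝ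
lift₂ f ne x y = mkℝ (λ n → f (seq x n) (seq y n)) isCauchy
  where
  isCauchy : IsCauchy (λ n → f (seq x n) (seq y n))
  isCauchy e 0<e with cauchy x (½ ℚ.* e) 0<½e | cauchy y (½ ℚ.* e) 0<½e
    where
    0<½e : 0ℚ ℚ.< ½ ℚ.* e
    0<½e = subst (ℚ._< ½ ℚ.* e) (ℚₚ.*-zeroʳ ½) (ℚₚ.*-monoʳ-<-pos ½ 0<e)
  ... | M , hM | N , hN = M ℕ.⊔ N , λ m n p q → ℚₚ.≤-<-trans
    (ne (seq x m) (seq y m) (seq x n) (seq y n))
    (subst (_ ℚ.<_) ½e+½e≡e (ℚₚ.+-mono-<
      (hM m n (ℕₚ.m⊔n≤o⇒m≤o M N p) (ℕₚ.m⊔n≤o⇒m≤o M N q))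
      (hN m n (ℕₚ.m⊔n≤o⇒n≤o M N p) (ℕₚ.m⊔n≤o⇒n≤o M N q))))
    where
    ½e+½e≡e : ½ ℚ.* e ℚ.+ ½ ℚ.* e ≡ e
    ½e+½e≡e = let open +-*-Solver in
      solve 1 (λ e → con ½ :* e :+ con ½ :* e := e) refl e

private
  p≤∣p∣ : ∀ p → p ℚ.≤ ℚ.∣ p ∣
  p≤∣p∣ p with ℚₚ.≤-total 0ℚ p
  ... | inj₁ 0≤p = ℚₚ.≤-reflexive (sym (ℚₚ.0≤p⇒∣p∣≡p 0≤p))
  ... | inj₂ p≤0 = ℚₚ.≤-trans p≤0 (ℚₚ.0≤∣p∣ p)

  ∣p-q∣≡∣q-p∣ : ∀ p q → ℚ.∣ p ℚ.- q ∣ ≡ ℚ.∣ q ℚ.- p ∣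
  ∣p-q∣≡∣q-p∣ p q = subst (λ r → ℚ.∣ r ∣ ≡ ℚ.∣ q ℚ.- p ∣)
    (solve 2 (λ p q → :- (q :- p) := p :- q) refl p q) (ℚₚ.∣-p∣≡∣p∣ (q ℚ.- p))
    where open +-*-Solver

  p≤q+r⇒p-q≤r : ∀ p q r → p ℚ.≤ q ℚ.+ r → p ℚ.- q ℚ.≤ r
  p≤q+r⇒p-q≤r p q r h = subst (p ℚ.- q ℚ.≤_)
    (solve 2 (λ q r → (q :+ r) :- q := r) refl q r) (ℚₚ.+-monoˡ-≤ (ℚ.- q) h)
    where open +-*-Solver

  p-q≤r⇒p≤q+r : ∀ p q r → p ℚ.- q ℚ.≤ r → p ℚ.≤ q ℚ.+ r
  p-q≤r⇒p≤q+r p q r h = subst (ℚ._≤ q ℚ.+ r)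
    (solve 2 (λ p q → q :+ (p :- q) := p) refl p q) (ℚₚ.+-monoʳ-≤ q h)
    where open +-*-Solver

  dist-≤ : ∀ p q r → p ℚ.≤ q ℚ.+ r → q ℚ.≤ p ℚ.+ r → ℚ.∣ p ℚ.- q ∣ ℚ.≤ r
  dist-≤ p q r h k with ℚₚ.≤-total 0ℚ (p ℚ.- q)
  ... | inj₁ 0≤ = subst (ℚ._≤ r) (sym (ℚₚ.0≤p⇒∣p∣≡p 0≤)) (p≤q+r⇒p-q≤r p q r h)
  ... | inj₂ ≤0 = subst (ℚ._≤ r) (sym ∣p-q∣≡q-p) (p≤q+r⇒p-q≤r q p r k)
    where
    0≤q-p : 0ℚ ℚ.≤ q ℚ.- p
    0≤q-p = subst (0ℚ ℚ.≤_)
      (let open +-*-Solver in solve 2 (λ p q → :- (p :- q) := q :- p) refl p q)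
      (ℚₚ.neg-antimono-≤ ≤0)
    ∣p-q∣≡q-p : ℚ.∣ p ℚ.- q ∣ ≡ q ℚ.- p
    ∣p-q∣≡q-p = subst (ℚ.∣ p ℚ.- q ∣ ≡_) (ℚₚ.0≤p⇒∣p∣≡p 0≤q-p) (∣p-q∣≡∣q-p∣ p q)

  bound₁ : ∀ a b c d → a ℚ.≤ c ℚ.+ (ℚ.∣ a ℚ.- c ∣ ℚ.+ ℚ.∣ b ℚ.- d ∣)
  bound₁ a b c d = ℚₚ.≤-trans
    (p-q≤r⇒p≤q+r a c _ (p≤∣p∣ (a ℚ.- c)))
    (ℚₚ.+-monoʳ-≤ c (subst (ℚ._≤ ℚ.∣ a ℚ.- c ∣ ℚ.+ ℚ.∣ b ℚ.- d ∣)
      (ℚₚ.+-identityʳ _) (ℚₚ.+-monoʳ-≤ ℚ.∣ a ℚ.- c ∣ (ℚₚ.0≤∣p∣ (b ℚ.- d)))))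

  bound₂ : ∀ a b c d → b ℚ.≤ d ℚ.+ (ℚ.∣ a ℚ.- c ∣ ℚ.+ ℚ.∣ b ℚ.- d ∣)
  bound₂ a b c d = subst (λ s → b ℚ.≤ d ℚ.+ s)
    (ℚₚ.+-comm ℚ.∣ b ℚ.- d ∣ ℚ.∣ a ℚ.- c ∣) (bound₁ b a d c)

  sum-swap : ∀ a b c d → ℚ.∣ a ℚ.- c ∣ ℚ.+ ℚ.∣ b ℚ.- d ∣ ≡ ℚ.∣ c ℚ.- a ∣ ℚ.+ ℚ.∣ d ℚ.- b ∣
  sum-swap a b c d = cong₂ ℚ._+_ (∣p-q∣≡∣q-p∣ a c) (∣p-q∣≡∣q-p∣ b d)

  monotone⇒nonExpansive : (f : ℚ → ℚ → ℚ) →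
    (∀ {a b c d} → a ℚ.≤ c → b ℚ.≤ d → f a b ℚ.≤ f c d) →
    (∀ r c d → f (c ℚ.+ r) (d ℚ.+ r) ≡ f c d ℚ.+ r) → NonExpansive f
  monotone⇒nonExpansive f mono trans a b c d =
    dist-≤ (f a b) (f c d) _ (half a b c d)
      (subst (λ s → f c d ℚ.≤ f a b ℚ.+ s) (sum-swap c d a b) (half c d a b))
    where
    half : ∀ a b c d → f a b ℚ.≤ f c d ℚ.+ (ℚ.∣ a ℚ.- c ∣ ℚ.+ ℚ.∣ b ℚ.- d ∣)
    half a b c d = subst (f a b ℚ.≤_) (trans _ c d)
      (mono (bound₁ a b c d) (bound₂ a b c d))

+-nonExpansive : NonExpansive ℚ._+_
+-nonExpansive a b c d = subst (λ s → ℚ.∣ s ∣ ℚ.≤ ℚ.∣ a ℚ.- c ∣ ℚ.+ ℚ.∣ b ℚ.- d ∣)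
  (solve 4 (λ a b c d → (a :- c) :+ (b :- d) := (a :+ b) :- (c :+ d)) refl a b c d)
  (ℚₚ.∣p+q∣≤∣p∣+∣q∣ (a ℚ.- c) (b ℚ.- d))
  where open +-*-Solver

-‿nonExpansive : NonExpansive ℚ._-_
-‿nonExpansive a b c d = subst (λ s → ℚ.∣ s ∣ ℚ.≤ ℚ.∣ a ℚ.- c ∣ ℚ.+ ℚ.∣ b ℚ.- d ∣)
  (solve 4 (λ a b c d → (a :- c) :- (b :- d) := (a :- b) :- (c :- d)) refl a b c d)
  (ℚₚ.∣p-q∣≤∣p∣+∣q∣ (a ℚ.- c) (b ℚ.- d))
  where open +-*-Solver

⊔-nonExpansive : NonExpansive ℚ._⊔_
⊔-nonExpansive = monotone⇒nonExpansive ℚ._⊔_ ℚₚ.⊔-mono-≤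
  (λ r c d → sym (ℚₚ.mono-≤-distrib-⊔ (ℚₚ.+-monoˡ-≤ r) c d))

⊓-nonExpansive : NonExpansive ℚ._⊓_
⊓-nonExpansive = monotone⇒nonExpansive ℚ._⊓_ ℚₚ.⊓-mono-≤
  (λ r c d → sym (ℚₚ.mono-≤-distrib-⊓ (ℚₚ.+-monoˡ-≤ r) c d))

_+_ _-_ _⊔_ _⊓_ : ℝ → ℝ → ℝ
_+_ = lift₂ ℚ._+_ +-nonExpansive
_-_ = lift₂ ℚ._-_ -‿nonExpansive
_⊔_ = lift₂ ℚ._⊔_ ⊔-nonExpansive
_⊓_ = lift₂ ℚ._⊓_ ⊓-nonExpansive

record Graph (n : ℕ) : Set₁ where
  field
    Adj    : Rel (Fin n) 0ℓ
    adj?   : Decidable Adj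
    symm   : Symmetric Adj
    irrefl : Irreflexive _≡_ Adj

module _ {n : ℕ} (G : Graph n) where
  open Graph G

  Walk : Rel (Fin n) 0ℓ
  Walk = Star Adj

  vertices : ∀ {u v} → Walk u v → List (Fin n)
  vertices {u} ε       = u ∷ []
  vertices {u} (_ ◅ p) = u ∷ vertices p

  IsPath : ∀ {u v} → Walk u v → Set
  IsPath p = Unique (vertices p)

  -- Any two vertices are joined by exactly one path. Paths are compared by
  -- their vertex sequences, as Adj need not be proof-irrelevant.
  IsTree : Set
  IsTree = ∀ u v → ∃! (_≡_ on vertices {u} {v}) IsPath

  -- Degree at most one, so that the vertex of a one-vertex tree is a leaf.
  -- Demanding degree exactly one would leave the one-vertex graph without any
  -- tree having it as its leaf set.
  IsLeaf : Fin n → Set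
  IsLeaf x = ∀ {y z} → Adj x y → Adj x z → y ≡ z

-- The values of weight on non-adjacent pairs are never used.
record WeightedTree (n : ℕ) : Set₁ where
  field
    graph  : Graph n
    isTree : IsTree graph
  open Graph graph public
  field
    weight        : Fin n → Fin n → ℝ
    weight-sym    : ∀ {x y} → Adj x y → weight x y ≃ weight y x
    weight-nonNeg : ∀ {x y} → Adj x y → 0ℝ ≤ weight x y

  walkWeight : ∀ {u v} → Walk graph u v → ℝ
  walkWeight ε                 = 0ℝ
  walkWeight (_◅_ {x} {y} _ p) = weight x y + walkWeight p

  dist : Fin n → Fin n → ℝ
  dist u v = walkWeight (proj₁ (isTree u v))

record IsPCG {n : ℕ} (G : Graph n) : Set₁ where
  open Graph G
  field
    {size} : ℕ
    tree   : WeightedTree size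
  open WeightedTree tree using (graph; dist)
  field
    leaf           : Fin n → Fin size
    leaf-injective : Injective _≡_ _≡_ leaf
    leaves         : ∀ x → IsLeaf graph x ⇔ (∃ λ v → leaf v ≡ x)
    dmin dmax      : ℝ
    0≤dmin         : 0ℝ ≤ dmin
    dmin≤dmax      : dmin ≤ dmax
    adjacent       : ∀ u v → u ≢ v →
      Adj u v ⇔ (dmin ≤ dist (leaf u) (leaf v) × dist (leaf u) (leaf v) ≤ dmax)

record Interval : Set where
  constructor [_,_]⟨_⟩
  field
    lower upper : ℝ
    lower≤upper : lower ≤ upper

-- The intersection is [max of lower ends , min of upper ends], with length 0
-- when those ends are in the wrong order.
∣_∩_∣ : Interval → Interval → ℝ
∣ I ∩ J ∣ = 0ℝ ⊔ ((upper I ⊓ upper J) - (lower I ⊔ lower J))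
  where open Interval

record IsToleranceGraph {n : ℕ} (G : Graph n) : Set where
  open Graph G
  field
    interval         : Fin n → Interval
    tolerance        : Fin n → ℝ
    tolerance-nonNeg : ∀ v → 0ℝ ≤ tolerance v
    adjacent         : ∀ x y → x ≢ y →
      Adj x y ⇔ (tolerance x ⊓ tolerance y ≤ ∣ interval x ∩ interval y ∣)

{-# OPTIONS --safe #-}
-- The witness is the join of two copies of 2K₂. It is the containment graph of
-- eight intervals, and taking the length of each interval as its tolerance
-- turns containment into adjacency.
--
-- Suppose it is a PCG. Tree distances satisfy the four-point condition: among
-- d ab + d cd, d ac + d bd and d ad + d bc the maximum is attained twice. In a
-- copy of 2K₂, if all non-edges were shorter than dmin, the sum over the two
-- edges would be the unique maximum; so some non-edge is longer than dmax. Take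
-- such a long non-edge aa′ in one copy and bb′ in the other. All four cross
-- pairs are edges, so d aa′ + d bb′ would be the unique maximum.
module Submission where

open import Defs
open import Data.Product using (∃₂; _×_)
open import Data.Nat.Base using (ℕ)
open import Relation.Nullary using (¬_)

open import Algebra.Bundles using (CommutativeMonoid)
import Algebra.Properties.CommutativeSemigroup as CommutativeSemigroupProperties
open import Level using (0ℓ)
import Data.Nat.Base as ℕ
import Data.Nat.Properties as ℕₚ
open import Data.Fin.Base using (Fin; _↑ˡ_; _↑ʳ_)
open import Data.Fin.Patterns
open import Data.Fin.Properties using (_≟_; all?)
import Data.Integer.Base as ℤ
open import Data.List.Base using (List; _∷_)
open import Data.List.Properties using (∷-injectiveˡ; ∷-injectiveʳ)
open import Data.List.Membership.Propositional using (_∈_; _∉_)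
import Data.List.Membership.DecPropositional as DecMembership
open import Data.List.Relation.Unary.All using ([])
open import Data.List.Relation.Unary.All.Properties using (¬Any⇒All¬; All¬⇒¬Any)
open import Data.List.Relation.Unary.AllPairs using ([]; _∷_)
open import Data.List.Relation.Unary.Any using (here; there)
open import Data.Product using (∃; _,_; proj₁; proj₂)
open import Data.Rational.Base as ℚ using (ℚ; 0ℚ; ½)
import Data.Rational.Properties as ℚₚ
open import Data.Rational.Solver using (module +-*-Solver)
open import Data.Sum.Base as Sum using (_⊎_; inj₁; inj₂; [_,_]′)
open import Data.Vec.Base using ([]; _∷_; lookup)
open import Function.Base using (_∘_; id)
open import Function.Bundles using (Equivalence; mk⇔)
import Relation.Binary.Reasoning.Preorder as PreorderReasoning
open import Relation.Binary.Bundles using (Preorder)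
open import Relation.Binary.Core using (Rel)
open import Relation.Binary.Structures using (IsPreorder)
open import Relation.Binary.Construct.Closure.ReflexiveTransitive using (ε; _◅_; _◅◅_)
open import Relation.Binary.PropositionalEquality
  using (_≡_; _≢_; refl; sym; trans; cong; cong₂; subst; subst₂)
open import Relation.Nullary using (yes; no; contradiction; ¬?)
open import Relation.Nullary.Decidable using (True; toWitness; from-yes; _×-dec_)

-- Path metric of a weighted tree and the four-point condition.

-- The tree arguments are carried out for weights in any such structure. `ℝ` fits with `_≃_` as
-- equality, Cauchy sequences not being quotiented.
record PreorderedCommutativeMonoid : Set₁ where
  infix 4 _≲_
  field
    commutativeMonoid : CommutativeMonoid 0ℓ 0ℓ
  open CommutativeMonoid commutativeMonoid public
    renaming (ε to 0#) hiding (refl; reflexive; trans)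
  field
    _≲_        : Rel Carrier 0ℓ
    isPreorder : IsPreorder _≈_ _≲_
    ∙-mono     : ∀ {x y u v} → x ≲ y → u ≲ v → x ∙ u ≲ y ∙ v

  preorder : Preorder 0ℓ 0ℓ 0ℓ
  preorder = record { isPreorder = isPreorder }

  ∙-monoˡ : ∀ {x y} z → x ≲ y → x ∙ z ≲ y ∙ z
  ∙-monoˡ z h = ∙-mono h (Preorder.refl preorder)

  ∙-monoʳ : ∀ z {x y} → x ≲ y → z ∙ x ≲ z ∙ y
  ∙-monoʳ z h = ∙-mono (Preorder.refl preorder) h

module TreeMetric
  (M : PreorderedCommutativeMonoid)
  {n : ℕ} (G : Graph n) (isTree : IsTree G)
  (weight : Fin n → Fin n → PreorderedCommutativeMonoid.Carrier M)
  (weight-sym : ∀ {x y} → Graph.Adj G x y →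
    PreorderedCommutativeMonoid._≈_ M (weight x y) (weight y x))
  (weight-nonNeg : ∀ {x y} → Graph.Adj G x y →
    PreorderedCommutativeMonoid._≲_ M (PreorderedCommutativeMonoid.0# M) (weight x y))
  where

  private
    module M = PreorderedCommutativeMonoid M

  open M using (Carrier; _∙_; _≲_; 0#; ∙-mono; ∙-monoˡ; ∙-monoʳ)
  open Graph G
  open Preorder M.preorder using ()
    renaming (refl to ≲-refl; reflexive to ≲-reflexive; trans to ≲-trans)
  open PreorderReasoning M.preorder
  open CommutativeSemigroupProperties M.commutativeSemigroup using (x∙yz≈y∙xz; xy∙z≈xz∙y)
  open DecMembership (_≟_ {n}) using (_∈?_)

  walkWeight : ∀ {u v} → Walk G u v → Carrier
  walkWeight ε                 = 0#
  walkWeight (_◅_ {x} {y} _ p) = weight x y ∙ walkWeight p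

  dist : Fin n → Fin n → Carrier
  dist u v = walkWeight (proj₁ (isTree u v))

  private
    W = Walk G
    vs : ∀ {u v} → W u v → List (Fin n)
    vs = vertices G

  source-≡ : ∀ {u u′ v v′} (p : W u v) (q : W u′ v′) → vs p ≡ vs q → u ≡ u′
  source-≡ ε       ε       eq = ∷-injectiveˡ eq
  source-≡ ε       (_ ◅ _) eq = ∷-injectiveˡ eq
  source-≡ (_ ◅ _) ε       eq = ∷-injectiveˡ eq
  source-≡ (_ ◅ _) (_ ◅ _) eq = ∷-injectiveˡ eq

  -- An edge is weighted by its endpoints, whatever the adjacency proof. So the uniqueness in
  -- `IsTree`, which compares vertex sequences only, still determines weights.
  walkWeight-cong : ∀ {u v} (p q : W u v) → vs p ≡ vs q → walkWeight p ≡ walkWeight q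
  walkWeight-cong ε       ε             eq = refl
  walkWeight-cong ε       (_ ◅ ε)       eq with () ← ∷-injectiveʳ eq
  walkWeight-cong ε       (_ ◅ (_ ◅ _)) eq with () ← ∷-injectiveʳ eq
  walkWeight-cong (_ ◅ ε) ε             eq with () ← ∷-injectiveʳ eq
  walkWeight-cong (_ ◅ (_ ◅ _)) ε       eq with () ← ∷-injectiveʳ eq
  walkWeight-cong {u} (_ ◅ p) (_ ◅ q) eq with source-≡ p q (∷-injectiveʳ eq)
  ... | refl = cong (weight u _ ∙_) (walkWeight-cong p q (∷-injectiveʳ eq))

  walkWeight-nonNeg : ∀ {u v} (p : W u v) → 0# ≲ walkWeight p
  walkWeight-nonNeg ε = ≲-refl
  walkWeight-nonNeg (_◅_ {x} {y} a p) = begin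
    0#                          ≈⟨ M.identityˡ 0# ⟨
    0# ∙ 0#                     ≲⟨ ∙-mono (weight-nonNeg a) (walkWeight-nonNeg p) ⟩
    weight x y ∙ walkWeight p   ∎

  walkWeight-◅◅ : ∀ {u v w} (p : W u v) (q : W v w) →
                  walkWeight (p ◅◅ q) ≲ walkWeight p ∙ walkWeight q
  walkWeight-◅◅ ε q = ≲-reflexive (M.sym (M.identityˡ (walkWeight q)))
  walkWeight-◅◅ (_◅_ {x} {y} _ p) q = begin
    weight x y ∙ walkWeight (p ◅◅ q)
      ≲⟨ ∙-monoʳ (weight x y) (walkWeight-◅◅ p q) ⟩
    weight x y ∙ (walkWeight p ∙ walkWeight q)
      ≈⟨ M.assoc (weight x y) (walkWeight p) (walkWeight q) ⟨
    (weight x y ∙ walkWeight p) ∙ walkWeight q ∎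

  vertices-◅◅ : ∀ {u v w x} (p : W u v) (q : W v w) → x ∈ vs (p ◅◅ q) → x ∈ vs p ⊎ x ∈ vs q
  vertices-◅◅ ε       q x∈       = inj₂ x∈
  vertices-◅◅ (_ ◅ p) q (here e) = inj₁ (here e)
  vertices-◅◅ (_ ◅ p) q (there x∈) = Sum.map₁ there (vertices-◅◅ p q x∈)

  -- Only the second half carries vertex and path information, because erasing a loop keeps just
  -- that half.
  splitAt : ∀ {u v w} (p : W u v) → w ∈ vs p → ∃₂ λ (p₁ : W u w) (p₂ : W w v) →
            walkWeight p₁ ∙ walkWeight p₂ ≲ walkWeight p ×
            (∀ {x} → x ∈ vs p₂ → x ∈ vs p) ×
            (IsPath G p → IsPath G p₂)
  splitAt ε           (here refl) = ε , ε , ≲-reflexive (M.identityˡ 0#) , id , id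
  splitAt p@(_ ◅ _)   (here refl) = ε , p , ≲-reflexive (M.identityˡ (walkWeight p)) , id , id
  splitAt (_◅_ {x} {y} a p) (there w∈) with splitAt p w∈
  ... | p₁ , p₂ , le , ⊆p , unique = a ◅ p₁ , p₂ , (begin
    (weight x y ∙ walkWeight p₁) ∙ walkWeight p₂
      ≈⟨ M.assoc (weight x y) (walkWeight p₁) (walkWeight p₂) ⟩
    weight x y ∙ (walkWeight p₁ ∙ walkWeight p₂)
      ≲⟨ ∙-monoʳ (weight x y) le ⟩
    weight x y ∙ walkWeight p ∎) , there ∘ ⊆p , λ { (_ ∷ up) → unique up }

  -- Loop erasure from the far end: if `u` recurs in the path already found, the suffix from that
  -- occurrence is kept. What is cut off has non-negative weight.
  toPath : ∀ {u v} (p : W u v) → ∃ λ (q : W u v) →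
           IsPath G q × (∀ {x} → x ∈ vs q → x ∈ vs p) × walkWeight q ≲ walkWeight p
  toPath ε = ε , [] ∷ [] , id , ≲-refl
  toPath (_◅_ {u} {y} a p) with toPath p
  ... | q , uq , q⊆p , q≲p with u ∈? vs q
  ...   | no u∉q = a ◅ q , ¬Any⇒All¬ (vs q) u∉q ∷ uq
                 , (λ { (here e) → here e ; (there x∈) → there (q⊆p x∈) })
                 , ∙-monoʳ (weight u y) q≲p
  ...   | yes u∈q with splitAt q u∈q
  ...     | q₁ , q₂ , le , q₂⊆q , unique = q₂ , unique uq , there ∘ q⊆p ∘ q₂⊆q , (begin
    walkWeight q₂                   ≈⟨ M.identityˡ (walkWeight q₂) ⟨
    0# ∙ walkWeight q₂              ≲⟨ ∙-monoˡ (walkWeight q₂) (walkWeight-nonNeg q₁) ⟩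
    walkWeight q₁ ∙ walkWeight q₂   ≲⟨ le ⟩
    walkWeight q                    ≈⟨ M.identityˡ (walkWeight q) ⟨
    0# ∙ walkWeight q               ≲⟨ ∙-mono (weight-nonNeg a) q≲p ⟩
    weight u y ∙ walkWeight p       ∎)

  reverseWalk : ∀ {u v} (p : W u v) → ∃ λ (q : W v u) → walkWeight q ≲ walkWeight p
  reverseWalk ε = ε , ≲-refl
  reverseWalk (_◅_ {x} {y} a p) with reverseWalk p
  ... | q , q≲p = q ◅◅ (symm a ◅ ε) , (begin
    walkWeight (q ◅◅ (symm a ◅ ε))       ≲⟨ walkWeight-◅◅ q (symm a ◅ ε) ⟩
    walkWeight q ∙ (weight y x ∙ 0#)     ≈⟨ M.comm (walkWeight q) (weight y x ∙ 0#) ⟩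
    (weight y x ∙ 0#) ∙ walkWeight q     ≲⟨ ∙-mono back q≲p ⟩
    weight x y ∙ walkWeight p            ∎)
    where
    back : weight y x ∙ 0# ≲ weight x y
    back = begin
      weight y x ∙ 0#   ≈⟨ M.comm (weight y x) 0# ⟩
      0# ∙ weight y x   ≈⟨ M.identityˡ (weight y x) ⟩
      weight y x        ≈⟨ weight-sym (symm a) ⟩
      weight x y        ∎

  path-unique : ∀ {u v} (p q : W u v) → IsPath G p → IsPath G q → vs p ≡ vs q
  path-unique {u} {v} p q up uq = trans (sym (unique up)) (unique uq)
    where
    unique : ∀ {r : W u v} → IsPath G r → vs (proj₁ (isTree u v)) ≡ vs r
    unique = proj₂ (proj₂ (isTree u v))

  dist≡pathWeight : ∀ {u v} (p : W u v) → IsPath G p → dist u v ≡ walkWeight p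
  dist≡pathWeight {u} {v} p up =
    walkWeight-cong _ p (path-unique _ p (proj₁ (proj₂ (isTree u v))) up)

  -- Loop erasure yields the tree path without raising the weight. Thus `dist` is a least walk
  -- weight, whence symmetry and the triangle inequality.
  dist≲walkWeight : ∀ {u v} (p : W u v) → dist u v ≲ walkWeight p
  dist≲walkWeight p with toPath p
  ... | q , uq , _ , q≲p = subst (_≲ walkWeight p) (sym (dist≡pathWeight q uq)) q≲p

  dist-sym : ∀ u v → dist u v ≲ dist v u
  dist-sym u v with reverseWalk (proj₁ (isTree v u))
  ... | q , le = ≲-trans (dist≲walkWeight q) le

  dist-triangle : ∀ u v w → dist u w ≲ dist u v ∙ dist v w
  dist-triangle u v w = begin
    dist u w               ≲⟨ dist≲walkWeight (p ◅◅ q) ⟩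
    walkWeight (p ◅◅ q)    ≲⟨ walkWeight-◅◅ p q ⟩
    dist u v ∙ dist v w    ∎
    where
    p = proj₁ (isTree u v)
    q = proj₁ (isTree v w)

  dist-splits : ∀ {u v w} (p : W u v) → w ∈ vs p → dist u w ∙ dist w v ≲ walkWeight p
  dist-splits {u} {v} {w} p w∈ with splitAt p w∈
  ... | p₁ , p₂ , le , _ = ≲-trans
    (∙-mono (dist≲walkWeight p₁) (dist≲walkWeight p₂)) le

  ∉-tail : ∀ {w h x} (a : Adj w h) (p : W h x) → IsPath G (a ◅ p) → w ∉ vs p
  ∉-tail _ _ (w∉p ∷ _) = All¬⇒¬Any w∉p

  prepend : ∀ {w h x} (a : Adj w h) (p : W h x) → w ∉ vs p →
            ∃ λ (q : W h x) → IsPath G (a ◅ q)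
  prepend a p w∉p with toPath p
  ... | q , uq , q⊆p , _ = q , ¬Any⇒All¬ (vs q) (w∉p ∘ q⊆p) ∷ uq

  -- A walk from x to z avoiding w would yield two paths from w to z, one
  -- through h and one through h′.
  branches-meet : ∀ {w h h′ x z} (a : Adj w h) (a′ : Adj w h′) → h ≢ h′ →
                  (p : W h x) → w ∉ vs p → (p′ : W h′ z) → w ∉ vs p′ →
                  (r : W x z) → w ∈ vs r
  branches-meet {w} a a′ h≢h′ p w∉p p′ w∉p′ r with w ∈? vs r
  ... | yes w∈r = w∈r
  ... | no  w∉r with prepend a (p ◅◅ r) ([ w∉p , w∉r ]′ ∘ vertices-◅◅ p r) | prepend a′ p′ w∉p′
  ...   | q , uq | q′ , uq′ = contradiction
    (source-≡ q q′ (∷-injectiveʳ (path-unique (a ◅ q) (a′ ◅ q′) uq uq′))) h≢h′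

  -- By `branches-meet` the tree path from `x` to `z` passes through `w`, so its weight splits
  -- there. This reverses the triangle inequality.
  dist-branches : ∀ {w h h′ x z} (a : Adj w h) (a′ : Adj w h′) → h ≢ h′ →
                  (p : W h x) → IsPath G (a ◅ p) → (p′ : W h′ z) → IsPath G (a′ ◅ p′) →
                  dist w x ∙ dist w z ≲ dist x z
  dist-branches {w} {x = x} {z} a a′ h≢h′ p up p′ up′ = begin
    dist w x ∙ dist w z   ≲⟨ ∙-monoˡ (dist w z) (dist-sym w x) ⟩
    dist x w ∙ dist w z   ≲⟨ dist-splits r (branches-meet a a′ h≢h′
                              p (∉-tail a p up) p′ (∉-tail a′ p′ up′) r) ⟩
    dist x z              ∎
    where r = proj₁ (isTree x z)

  dist-triangle′ : ∀ w x y → dist x y ≲ dist w x ∙ dist w y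
  dist-triangle′ w x y = begin
    dist x y              ≲⟨ dist-triangle x w y ⟩
    dist x w ∙ dist w y   ≲⟨ ∙-monoˡ (dist w y) (dist-sym x w) ⟩
    dist w x ∙ dist w y   ∎

  -- One sum is bounded by the larger of the other two. As a disjunction it can be settled by
  -- comparing vertices, which is decidable, instead of weights.
  FourPoint : (x y z w : Fin n) → Set
  FourPoint x y z w = dist x y ∙ dist w z ≲ dist x z ∙ dist w y
                    ⊎ dist x y ∙ dist w z ≲ dist y z ∙ dist w x

  -- Move w towards x, y and z. As long as the three paths agree, every sum loses
  -- the weight of the edge crossed; once the path to z leaves the one to x or to
  -- y, the distance from z to that vertex splits at w.
  fourPoint-paths : ∀ {w x y z} (p : W w x) (q : W w y) (r : W w z) →
                    IsPath G p → IsPath G q → IsPath G r → FourPoint x y z w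
  fourPoint-paths {w} {y = y} {z} ε _ _ _ _ _ =
    inj₁ (≲-reflexive (M.comm (dist w y) (dist w z)))
  fourPoint-paths {w} {x} {z = z} (_ ◅ _) ε _ _ _ _ =
    inj₂ (begin
      dist x w ∙ dist w z   ≲⟨ ∙-monoˡ (dist w z) (dist-sym x w) ⟩
      dist w x ∙ dist w z   ≈⟨ M.comm (dist w x) (dist w z) ⟩
      dist w z ∙ dist w x   ∎)
  fourPoint-paths {w} {x} {y} (_ ◅ _) (_ ◅ _) ε _ _ _ =
    inj₁ (begin
      dist x y ∙ dist w w            ≲⟨ ∙-mono (dist-triangle x w y) (dist≲walkWeight ε) ⟩
      (dist x w ∙ dist w y) ∙ 0#     ≈⟨ M.comm (dist x w ∙ dist w y) 0# ⟩
      0# ∙ (dist x w ∙ dist w y)     ≈⟨ M.identityˡ (dist x w ∙ dist w y) ⟩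
      dist x w ∙ dist w y            ∎)
  fourPoint-paths {w} {x} {y} {z}
    (_◅_ {j = h₁} a₁ p) (_◅_ {j = h₂} a₂ q) (_◅_ {j = h₃} a₃ r) up uq ur
    with h₁ ≟ h₃ | h₂ ≟ h₃
  ... | no h₁≢h₃ | _ = inj₁ (begin
    dist x y ∙ dist w z
      ≲⟨ ∙-monoˡ (dist w z) (dist-triangle′ w x y) ⟩
    (dist w x ∙ dist w y) ∙ dist w z
      ≈⟨ xy∙z≈xz∙y (dist w x) (dist w y) (dist w z) ⟩
    (dist w x ∙ dist w z) ∙ dist w y
      ≲⟨ ∙-monoˡ (dist w y) (dist-branches a₁ a₃ h₁≢h₃ p up r ur) ⟩
    dist x z ∙ dist w y ∎)
  ... | yes _ | no h₂≢h₃ = inj₂ (begin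
    dist x y ∙ dist w z
      ≲⟨ ∙-monoˡ (dist w z) (dist-triangle′ w x y) ⟩
    (dist w x ∙ dist w y) ∙ dist w z
      ≈⟨ M.assoc (dist w x) (dist w y) (dist w z) ⟩
    dist w x ∙ (dist w y ∙ dist w z)
      ≈⟨ M.comm (dist w x) (dist w y ∙ dist w z) ⟩
    (dist w y ∙ dist w z) ∙ dist w x
      ≲⟨ ∙-monoˡ (dist w x) (dist-branches a₂ a₃ h₂≢h₃ q uq r ur) ⟩
    dist y z ∙ dist w x ∎)
  ... | yes refl | yes refl
    with fourPoint-paths p q r (tail a₁ up) (tail a₂ uq) (tail a₃ ur)
    where
    tail : ∀ {v} (a : Adj w h₃) {s : W h₃ v} → IsPath G (a ◅ s) → IsPath G s
    tail _ (_ ∷ us) = us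
  ...   | h = Sum.map (extend (dist x y) (dist x z) a₃ r ur a₂ q uq)
                      (extend (dist x y) (dist y z) a₃ r ur a₁ p up) h
    where
    dist-step : ∀ {v} (a : Adj w h₃) (s : W h₃ v) → IsPath G (a ◅ s) →
                dist w v ≡ weight w h₃ ∙ dist h₃ v
    dist-step a s us@(_ ∷ us′) =
      trans (dist≡pathWeight (a ◅ s) us)
        (cong (weight w h₃ ∙_) (sym (dist≡pathWeight s us′)))

    -- Each sum contains exactly one distance from `w`, so both sides gain the same `c`. The two
    -- paths cross this edge with possibly different adjacency proofs, hence `a` and `b`.
    extend : ∀ A B {u v} (a : Adj w h₃) (s : W h₃ u) → IsPath G (a ◅ s) →
             (b : Adj w h₃) (t : W h₃ v) → IsPath G (b ◅ t) →
             A ∙ dist h₃ u ≲ B ∙ dist h₃ v → A ∙ dist w u ≲ B ∙ dist w v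
    extend A B {u} {v} a s us b t ut le rewrite dist-step a s us | dist-step b t ut = begin
      A ∙ (c ∙ dist h₃ u)     ≈⟨ x∙yz≈y∙xz A c (dist h₃ u) ⟩
      c ∙ (A ∙ dist h₃ u)     ≲⟨ ∙-monoʳ c le ⟩
      c ∙ (B ∙ dist h₃ v)     ≈⟨ x∙yz≈y∙xz c B (dist h₃ v) ⟩
      B ∙ (c ∙ dist h₃ v)     ∎
      where c = weight w h₃

  fourPoint : ∀ x y z w → FourPoint x y z w
  fourPoint x y z w = fourPoint-paths
    (proj₁ (isTree w x)) (proj₁ (isTree w y)) (proj₁ (isTree w z))
    (proj₁ (proj₂ (isTree w x))) (proj₁ (proj₂ (isTree w y))) (proj₁ (proj₂ (isTree w z)))

-- Order and addition of Cauchy reals.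

half : ℚ → ℚ
half e = ½ ℚ.* e

half-pos : ∀ {e} → 0ℚ ℚ.< e → 0ℚ ℚ.< half e
half-pos {e} 0<e = subst (ℚ._< half e) (ℚₚ.*-zeroʳ ½) (ℚₚ.*-monoʳ-<-pos ½ 0<e)

∣p-q∣≤r⇒p≤q+r : ∀ p q {r} → ℚ.∣ p ℚ.- q ∣ ℚ.≤ r → p ℚ.≤ q ℚ.+ r
∣p-q∣≤r⇒p≤q+r p q {r} h =
  subst (ℚ._≤ q ℚ.+ r) (solve 2 (λ p q → q :+ (p :- q) := p) refl p q)
    (ℚₚ.+-monoʳ-≤ q (ℚₚ.≤-trans (s≤∣s∣ (p ℚ.- q)) h))
  where
  open +-*-Solver
  s≤∣s∣ : ∀ s → s ℚ.≤ ℚ.∣ s ∣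
  s≤∣s∣ s with ℚₚ.≤-total 0ℚ s
  ... | inj₁ 0≤s = ℚₚ.≤-reflexive (sym (ℚₚ.0≤p⇒∣p∣≡p 0≤s))
  ... | inj₂ s≤0 = ℚₚ.≤-trans s≤0 (ℚₚ.0≤∣p∣ s)

+ᵠ-cancelʳ-≤ : ∀ r {p q} → p ℚ.+ r ℚ.≤ q ℚ.+ r → p ℚ.≤ q
+ᵠ-cancelʳ-≤ r {p} {q} h =
  subst₂ ℚ._≤_ (cancel p) (cancel q) (ℚₚ.+-monoˡ-≤ (ℚ.- r) h)
  where
  cancel : ∀ s → (s ℚ.+ r) ℚ.- r ≡ s
  cancel s = let open +-*-Solver in
    solve 2 (λ s r → (s :+ r) :- r := s) refl s r

pointwise-≤ : ∀ x y → (∀ n → seq x n ℚ.≤ seq y n) → x ≤ y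
pointwise-≤ x y h e 0<e = 0 , λ n _ →
  subst (ℚ._≤ seq y n ℚ.+ e) (ℚₚ.+-identityʳ _) (ℚₚ.+-mono-≤ (h n) (ℚₚ.<⇒≤ 0<e))

≤-refl : ∀ {x} → x ≤ x
≤-refl {x} = pointwise-≤ x x λ _ → ℚₚ.≤-refl

≤-trans : ∀ {x y z} → x ≤ y → y ≤ z → x ≤ z
≤-trans {x} {y} {z} x≤y y≤z e 0<e
  with x≤y (half e) (half-pos 0<e) | y≤z (half e) (half-pos 0<e)
... | M , hM | N , hN = M ℕ.⊔ N , λ n p →
  ℚₚ.≤-trans (hM n (ℕₚ.m⊔n≤o⇒m≤o M N p))
    (subst (seq y n ℚ.+ half e ℚ.≤_)
      (solve 2 (λ z e → (z :+ con ½ :* e) :+ con ½ :* e := z :+ e) refl (seq z n) e)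
      (ℚₚ.+-monoˡ-≤ (half e) (hN n (ℕₚ.m⊔n≤o⇒n≤o M N p))))
  where open +-*-Solver

+-mono-≤ : ∀ {x y u v} → x ≤ y → u ≤ v → x + u ≤ y + v
+-mono-≤ {x} {y} {u} {v} x≤y u≤v e 0<e
  with x≤y (half e) (half-pos 0<e) | u≤v (half e) (half-pos 0<e)
... | M , hM | N , hN = M ℕ.⊔ N , λ n p →
  subst (seq x n ℚ.+ seq u n ℚ.≤_)
    (solve 3 (λ y v e → (y :+ con ½ :* e) :+ (v :+ con ½ :* e) := (y :+ v) :+ e)
      refl (seq y n) (seq v n) e)
    (ℚₚ.+-mono-≤ (hM n (ℕₚ.m⊔n≤o⇒m≤o M N p)) (hN n (ℕₚ.m⊔n≤o⇒n≤o M N p)))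
  where open +-*-Solver

pointwise-≃ : ∀ x y → (∀ n → seq x n ≡ seq y n) → x ≃ y
pointwise-≃ x y h = pointwise-≤ x y (ℚₚ.≤-reflexive ∘ h)
                  , pointwise-≤ y x (ℚₚ.≤-reflexive ∘ sym ∘ h)

≤-isPreorder : IsPreorder _≃_ _≤_
≤-isPreorder = record
  { isEquivalence = record
    { refl  = λ {x} → ≤-refl {x} , ≤-refl {x}
    ; sym   = λ (x≤y , y≤x) → y≤x , x≤y
    ; trans = λ {x} {y} {z} (x≤y , y≤x) (y≤z , z≤y) →
        ≤-trans {x} {y} {z} x≤y y≤z , ≤-trans {z} {y} {x} z≤y y≤x
    }
  ; reflexive = proj₁
  ; trans     = λ {x} {y} {z} → ≤-trans {x} {y} {z}
  }

+-0-commutativeMonoid : CommutativeMonoid 0ℓ 0ℓ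
+-0-commutativeMonoid = record
  { Carrier = ℝ
  ; _≈_     = _≃_
  ; _∙_     = _+_
  ; ε       = 0ℝ
  ; isCommutativeMonoid = record
    { isMonoid = record
      { isSemigroup = record
        { isMagma = record
          { isEquivalence = IsPreorder.isEquivalence ≤-isPreorder
          ; ∙-cong        = λ {x} {y} {u} {v} (x≤y , y≤x) (u≤v , v≤u) →
              +-mono-≤ {x} {y} {u} {v} x≤y u≤v , +-mono-≤ {y} {x} {v} {u} y≤x v≤u
          }
        ; assoc = λ x y z → pointwise-≃ (x + y + z) (x + (y + z)) λ n →
            ℚₚ.+-assoc (seq x n) (seq y n) (seq z n)
        }
      ; identity = (λ x → pointwise-≃ (0ℝ + x) x λ n → ℚₚ.+-identityˡ (seq x n))
                 , (λ x → pointwise-≃ (x + 0ℝ) x λ n → ℚₚ.+-identityʳ (seq x n))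
      }
    ; comm = λ x y → pointwise-≃ (x + y) (y + x) λ n → ℚₚ.+-comm (seq x n) (seq y n)
    }
  }

+-0-preorderedCommutativeMonoid : PreorderedCommutativeMonoid
+-0-preorderedCommutativeMonoid = record
  { commutativeMonoid = +-0-commutativeMonoid
  ; isPreorder        = ≤-isPreorder
  ; ∙-mono            = λ {x} {y} {u} {v} → +-mono-≤ {x} {y} {u} {v}
  }

+-cancelʳ-≤ : ∀ z {x y} → x + z ≤ y + z → x ≤ y
+-cancelʳ-≤ z {x} {y} h e 0<e with h e 0<e
... | N , hN = N , λ n p → +ᵠ-cancelʳ-≤ (seq z n)
  (subst (seq x n ℚ.+ seq z n ℚ.≤_)
    (solve 3 (λ y z e → (y :+ z) :+ e := (y :+ e) :+ z) refl (seq y n) (seq z n) e)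
    (hN n p))
  where open +-*-Solver

-- Either y N ≤ x N + 2h at a late index N, and then y n ≤ x n + 4h from there
-- on, or the gap exceeds 2h and x stays below y.
≰⇒≥ : ∀ x y → ¬ x ≤ y → y ≤ x
≰⇒≥ x y x≰y e 0<e
  with cauchy x (half (half e)) (half-pos (half-pos 0<e))
     | cauchy y (half (half e)) (half-pos (half-pos 0<e))
... | M₁ , hx | M₂ , hy = go (ℚₚ.≤-total (seq y M) (seq x M ℚ.+ (h ℚ.+ h)))
  where
  open +-*-Solver
  h = half (half e)
  M = M₁ ℕ.⊔ M₂

  near : ∀ z {K} → (∀ m n → K ℕ.≤ m → K ℕ.≤ n → ℚ.∣ seq z m ℚ.- seq z n ∣ ℚ.< h) →
         ∀ {m n} → K ℕ.≤ m → K ℕ.≤ n → seq z m ℚ.≤ seq z n ℚ.+ h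
  near z hz p q = ∣p-q∣≤r⇒p≤q+r (seq z _) (seq z _) (ℚₚ.<⇒≤ (hz _ _ p q))

  M₁≤ : ∀ {n} → M ℕ.≤ n → M₁ ℕ.≤ n
  M₁≤ = ℕₚ.m⊔n≤o⇒m≤o M₁ M₂

  M₂≤ : ∀ {n} → M ℕ.≤ n → M₂ ℕ.≤ n
  M₂≤ = ℕₚ.m⊔n≤o⇒n≤o M₁ M₂

  open ℚₚ.≤-Reasoning

  go : seq y M ℚ.≤ seq x M ℚ.+ (h ℚ.+ h) ⊎ seq x M ℚ.+ (h ℚ.+ h) ℚ.≤ seq y M →
       ∃ λ N → ∀ n → N ℕ.≤ n → seq y n ℚ.≤ seq x n ℚ.+ e
  go (inj₁ close) = M , λ n p → begin
    seq y n                              ≤⟨ near y hy (M₂≤ p) (M₂≤ ℕₚ.≤-refl) ⟩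
    seq y M ℚ.+ h                        ≤⟨ ℚₚ.+-monoˡ-≤ h close ⟩
    (seq x M ℚ.+ (h ℚ.+ h)) ℚ.+ h        ≤⟨ ℚₚ.+-monoˡ-≤ h (ℚₚ.+-monoˡ-≤ (h ℚ.+ h)
                                              (near x hx (M₁≤ ℕₚ.≤-refl) (M₁≤ p))) ⟩
    ((seq x n ℚ.+ h) ℚ.+ (h ℚ.+ h)) ℚ.+ h
      ≡⟨ solve 2 (λ x e → let h = con ½ :* (con ½ :* e) in
                   ((x :+ h) :+ (h :+ h)) :+ h := x :+ e) refl (seq x n) e ⟩
    seq x n ℚ.+ e                        ∎
  go (inj₂ apart) = contradiction
    (λ e′ 0<e′ → M , λ n p → begin
      seq x n           ≤⟨ +ᵠ-cancelʳ-≤ h (begin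
        seq x n ℚ.+ h           ≤⟨ ℚₚ.+-monoˡ-≤ h (near x hx (M₁≤ p) (M₁≤ ℕₚ.≤-refl)) ⟩
        (seq x M ℚ.+ h) ℚ.+ h   ≡⟨ ℚₚ.+-assoc (seq x M) h h ⟩
        seq x M ℚ.+ (h ℚ.+ h)   ≤⟨ apart ⟩
        seq y M                 ≤⟨ near y hy (M₂≤ ℕₚ.≤-refl) (M₂≤ p) ⟩
        seq y n ℚ.+ h           ∎) ⟩
      seq y n           ≡⟨ ℚₚ.+-identityʳ (seq y n) ⟨
      seq y n ℚ.+ 0ℚ    ≤⟨ ℚₚ.+-monoʳ-≤ (seq y n) (ℚₚ.<⇒≤ 0<e′) ⟩
      seq y n ℚ.+ e′    ∎)
    x≰y

-- Failure of `b ≤ d` gives `d ≤ b`, so `a + b ≤ c + d ≤ c + b`, and `b` cancels. The order on `ℝ`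
-- is not decided, so the conclusion refutes both failures at once instead of choosing a side.
+-≤-pigeonhole : ∀ {a b c d} → a + b ≤ c + d → ¬ (¬ a ≤ c × ¬ b ≤ d)
+-≤-pigeonhole {a} {b} {c} {d} h (a≰c , b≰d) = a≰c
  (+-cancelʳ-≤ b {a} {c} (≤-trans {a + b} {c + d} {c + b} h
    (+-mono-≤ {c} {c} {d} {b} (≤-refl {c}) (≰⇒≥ b d b≰d))))

fromℚ-mono-≤ : ∀ {p q} → p ℚ.≤ q → fromℚ p ≤ fromℚ q
fromℚ-mono-≤ {p} {q} p≤q = pointwise-≤ (fromℚ p) (fromℚ q) λ _ → p≤q

fromℚ-cancel-≤ : ∀ {p q} → fromℚ p ≤ fromℚ q → p ℚ.≤ q
fromℚ-cancel-≤ {p} {q} h with p ℚₚ.≤? q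
... | yes p≤q = p≤q
... | no  p≰q with ℚₚ.<-dense (ℚₚ.≰⇒> p≰q)
-- The slack `m - q` turns the hypothesis into `p ≤ m`, against `m < p`.
...   | m , q<m , m<p with h (m ℚ.- q) (subst (ℚ._< m ℚ.- q) (ℚₚ.+-inverseʳ q)
                                           (ℚₚ.+-monoˡ-< (ℚ.- q) q<m))
...     | N , hN = contradiction
  (ℚₚ.<-≤-trans m<p (subst (p ℚ.≤_)
    (let open +-*-Solver in solve 2 (λ m q → q :+ (m :- q) := m) refl m q)
    (hN N ℕₚ.≤-refl)))
  (ℚₚ.<-irrefl refl)

-- Constraints on leaf distances in a pairwise compatibility graph.

module _ {n : ℕ} {G : Graph n} (P : IsPCG G) where
  open Graph G
  open IsPCG P
  open WeightedTree tree using (graph; isTree; weight; weight-sym; weight-nonNeg; walkWeight; dist)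
  module T = TreeMetric +-0-preorderedCommutativeMonoid graph isTree weight weight-sym weight-nonNeg

  -- Both sides follow the same recursion, but as separate definitions they agree on a general walk
  -- only by induction.
  walkWeight≡ : ∀ {u v} (p : Walk graph u v) → T.walkWeight p ≡ walkWeight p
  walkWeight≡ ε                 = refl
  walkWeight≡ (_◅_ {x} {y} _ p) = cong (weight x y +_) (walkWeight≡ p)

  D : Fin n → Fin n → ℝ
  D u v = T.dist (leaf u) (leaf v)

  D≡dist : ∀ u v → D u v ≡ dist (leaf u) (leaf v)
  D≡dist u v = walkWeight≡ (proj₁ (isTree (leaf u) (leaf v)))

  NonAdj : Fin n → Fin n → Set
  NonAdj u v = u ≢ v × ¬ Adj u v

  Long : Fin n → Fin n → Set
  Long u v = ¬ D u v ≤ dmax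

  adjacent⇒bounds : ∀ {u v} → Adj u v → dmin ≤ D u v × D u v ≤ dmax
  adjacent⇒bounds {u} {v} a =
    subst (λ d → dmin ≤ d × d ≤ dmax) (sym (D≡dist u v))
      (Equivalence.to (adjacent u v (λ u≡v → irrefl u≡v a)) a)

  short-nonedge : ∀ {u v} → NonAdj u v → D u v ≤ dmax → ¬ dmin ≤ D u v
  short-nonedge {u} {v} (u≢v , ¬a) ≤dmax dmin≤ =
    ¬a (Equivalence.from (adjacent u v u≢v)
      (subst (λ d → dmin ≤ d × d ≤ dmax) (D≡dist u v) (dmin≤ , ≤dmax)))

  fourPoint : ∀ x y z w → D x y + D w z ≤ D x z + D w y ⊎ D x y + D w z ≤ D y z + D w x
  fourPoint x y z w = T.fourPoint (leaf x) (leaf y) (leaf z) (leaf w)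

  -- The two edges force the right-hand sum up to `dmin + dmin`, while non-edges that are not long
  -- lie below `dmin`.
  nonedges-exceed : ∀ {a b c d s t u v} → Adj a b → Adj c d → NonAdj s t → NonAdj u v →
                    D a b + D c d ≤ D s t + D u v → ¬ (¬ Long s t × ¬ Long u v)
  nonedges-exceed {a} {b} {c} {d} {s} {t} {u} {v} ab cd st uv h (¬st> , ¬uv>) =
    -- The goal is empty, so each doubly negated bound by `dmax` may be used as the bound itself.
    ¬st> λ st≤ → ¬uv> λ uv≤ →
      +-≤-pigeonhole {dmin} {dmin} {D s t} {D u v}
        (≤-trans {dmin + dmin} {D a b + D c d} {D s t + D u v}
          (+-mono-≤ {dmin} {D a b} {dmin} {D c d}
            (proj₁ (adjacent⇒bounds ab)) (proj₁ (adjacent⇒bounds cd)))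
          h)
        (short-nonedge st st≤ , short-nonedge uv uv≤)

  long-nonedge : ∀ {a b c d} → Adj a b → Adj c d →
                 NonAdj a d → NonAdj c b → NonAdj b d → NonAdj c a →
                 ¬ (¬ Long a d × ¬ Long c b × ¬ Long b d × ¬ Long c a)
  long-nonedge {a} {b} {c} {d} ab cd ad cb bd ca (¬ad> , ¬cb> , ¬bd> , ¬ca>) =
    -- In this order the sum over the two edges is the bounded one, and the alternatives are the two
    -- perfect matchings by non-edges.
    go (fourPoint a b d c)
    where
    go : ¬ (D a b + D c d ≤ D a d + D c b ⊎ D a b + D c d ≤ D b d + D c a)
    go (inj₁ h) = nonedges-exceed {a} {b} {c} {d} {a} {d} {c} {b} ab cd ad cb h (¬ad> , ¬cb>)
    go (inj₂ h) = nonedges-exceed {a} {b} {c} {d} {b} {d} {c} {a} ab cd bd ca h (¬bd> , ¬ca>)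

  -- Dual to `nonedges-exceed`: the two edges keep the right-hand sum within `dmax + dmax`.
  longs-exceed : ∀ {a b c d s t u v} → Long a b → Long c d → Adj s t → Adj u v →
                 ¬ D a b + D c d ≤ D s t + D u v
  longs-exceed {a} {b} {c} {d} {s} {t} {u} {v} ab> cd> st uv h =
    +-≤-pigeonhole {D a b} {D c d} {dmax} {dmax}
      (≤-trans {D a b + D c d} {D s t + D u v} {dmax + dmax} h
        (+-mono-≤ {D s t} {dmax} {D u v} {dmax}
          (proj₂ (adjacent⇒bounds st)) (proj₂ (adjacent⇒bounds uv))))
      (ab> , cd>)

  -- Both sums that could bound `D a a′ + D b b′` in the four-point condition run over cross pairs,
  -- which are edges.
  no-crossing-longs : ∀ {a a′ b b′} → Adj a b → Adj a b′ → Adj a′ b → Adj a′ b′ →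
                      Long a a′ → ¬ Long b b′
  no-crossing-longs {a} {a′} {b} {b′} ab ab′ a′b a′b′ aa′> bb′> =
    go (fourPoint a a′ b′ b)
    where
    go : ¬ (D a a′ + D b b′ ≤ D a b′ + D b a′ ⊎ D a a′ + D b b′ ≤ D a′ b′ + D b a)
    go (inj₁ h) = longs-exceed {a} {a′} {b} {b′} {a} {b′} {b} {a′} aa′> bb′> ab′ (symm a′b) h
    go (inj₂ h) = longs-exceed {a} {a′} {b} {b′} {a′} {b′} {b} {a} aa′> bb′> a′b′ (symm ab) h

-- The graph, its tolerance representation and the contradiction.

-- Indices 0–3 and 4–7 are the two copies of 2K₂. The containments are
-- 0 ⊆ 1, 2 ⊆ 3, 4 ⊆ 5, 6 ⊆ 7, and each of 0–3 in each of 4–7.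
lo hi len : Fin 8 → ℚ
lo  x = ℤ.+ lookup (4 ∷ 4 ∷ 7 ∷ 7 ∷  2 ∷  1 ∷  3 ∷  3 ∷ []) x ℚ./ 1
hi  x = ℤ.+ lookup (5 ∷ 6 ∷ 8 ∷ 9 ∷ 10 ∷ 10 ∷ 11 ∷ 12 ∷ []) x ℚ./ 1
len x = hi x ℚ.- lo x

∩-length : Fin 8 → Fin 8 → ℚ
∩-length x y = 0ℚ ℚ.⊔ (hi x ℚ.⊓ hi y ℚ.- (lo x ℚ.⊔ lo y))

∩-length-comm : ∀ x y → ∩-length x y ≡ ∩-length y x
∩-length-comm x y = cong (0ℚ ℚ.⊔_)
  (cong₂ ℚ._-_ (ℚₚ.⊓-comm (hi x) (hi y)) (ℚₚ.⊔-comm (lo x) (lo y)))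

-- Adjacency is the tolerance criterion itself, read over `ℚ`, where it is decidable. The
-- representation is then immediate, and particular edges and non-edges are found by evaluation.
2K₂-join-2K₂ : Graph 8
2K₂-join-2K₂ = record
  { Adj    = λ x y → x ≢ y × len x ℚ.⊓ len y ℚ.≤ ∩-length x y
  ; adj?   = λ x y → ¬? (x ≟ y) ×-dec (len x ℚ.⊓ len y ℚₚ.≤? ∩-length x y)
  ; symm   = λ {x} {y} (x≢y , le) → x≢y ∘ sym ,
      subst₂ ℚ._≤_ (ℚₚ.⊓-comm (len x) (len y)) (∩-length-comm x y) le
  ; irrefl = λ x≡y (x≢y , _) → x≢y x≡y
  }

open Graph 2K₂-join-2K₂ using (Adj; adj?)

2K₂-join-2K₂-isTolerance : IsToleranceGraph 2K₂-join-2K₂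
2K₂-join-2K₂-isTolerance = record
  { interval         = λ x → record
      { lower       = fromℚ (lo x)
      ; upper       = fromℚ (hi x)
      ; lower≤upper = fromℚ-mono-≤ (from-yes (all? λ x → lo x ℚₚ.≤? hi x) x)
      }
  ; tolerance        = λ x → fromℚ (len x)
  ; tolerance-nonNeg = λ x → fromℚ-mono-≤ (from-yes (all? λ x → 0ℚ ℚₚ.≤? len x) x)
  ; adjacent         = λ x y x≢y → mk⇔
      -- The real operations on constant sequences compute to constant sequences, and `_≤_` inspects
      -- only `seq`, so the rational inequality is all that has to be transferred.
      (λ (_ , le) → fromℚ-mono-≤ le)
      (λ le → x≢y , fromℚ-cancel-≤ le)
  }

left right : Fin 4 → Fin 8
left i = i ↑ˡ 4
right i = 4 ↑ʳ i

joined : ∀ i j → Adj (left i) (right j)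
joined = from-yes (all? λ i → all? λ j → adj? (left i) (right j))

2K₂-join-2K₂-notPCG : ¬ IsPCG 2K₂-join-2K₂
2K₂-join-2K₂-notPCG P = long-nonedge P {left 0F} {left 1F} {left 2F} {left 3F}
  (from-yes (adj? 0F 1F)) (from-yes (adj? 2F 3F))
  (nonAdj 0F 3F) (nonAdj 2F 1F) (nonAdj 1F 3F) (nonAdj 2F 0F)
  (not-long 0F 3F , not-long 2F 1F , not-long 1F 3F , not-long 2F 0F)
  where
  nonAdj : ∀ u v {_ : True (¬? (u ≟ v) ×-dec ¬? (adj? u v))} → NonAdj P u v
  nonAdj u v {t} = toWitness t

  -- No particular long pair can be extracted from `long-nonedge`. Instead, any long left pair would
  -- keep every right pair from being long, against `long-nonedge` for the right copy.
  not-long : ∀ i i′ → ¬ Long P (left i) (left i′)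
  not-long i i′ long = long-nonedge P {right 0F} {right 1F} {right 2F} {right 3F}
    (from-yes (adj? 4F 5F)) (from-yes (adj? 6F 7F))
    (nonAdj 4F 7F) (nonAdj 6F 5F) (nonAdj 5F 7F) (nonAdj 6F 4F)
    (cross 0F 3F , cross 2F 1F , cross 1F 3F , cross 2F 0F)
    where
    cross : ∀ j j′ → ¬ Long P (right j) (right j′)
    cross j j′ long′ = no-crossing-longs P
      (joined i j) (joined i j′) (joined i′ j) (joined i′ j′) long long′

theorem2 : ∃₂ λ (n : ℕ) (G : Graph n) → IsToleranceGraph G × ¬ IsPCG G
theorem2 = 8 , 2K₂-join-2K₂ , 2K₂-join-2K₂-isTolerance , 2K₂-join-2K₂-notPCG
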